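{- For every formula $\varphi\in\mathcal L^*_\Box$, $\varphi$ is valid in all $\mathsf{CK}$-models if and only if $\varphi$ is valid in all $\mathsf{WK}$-models.
   Context: Language. Let $\mathrm{Prop}$ be a set of proposition symbols. $\mathcal L^*_\Box$ is given by $\varphi ::= \bot \mid p\mid \varphi\land\varphi \mid \varphi\lor\varphi \mid \varphi\to\varphi \mid \Box\varphi \mid \Box^*\varphi$, with $p\in\mathrm{Prop}$. Relations. $(R;S)$ is composition: $x(R;S)y$ iff there is $z$ with $xRz$ and $zSy$. $R^*$ is the reflexive-transitive closure of $R$. Models. A $\mathsf{CK}$-model is $\mathcal M=(W,\preccurlyeq,R,\|\cdot\|)$ where $\preccurlyeq$ is a preorder on $W$, $R$ is any binary relation on $W$, and $\|\cdot\|:\mathrm{Prop}\cup\{\bot\}\to\mathcal P(W)$ is such that for all $p\in\mathrm{Prop}$: (1) $\|\bot\|\subseteq\|p\|$; (2) if $w\preccurlyeq v$ and $w\in\|p\|$ then $v\in\|p\|$; (3) if $w\in\|\bot\|$ and ($w\preccurlyeq v$ or $wRv$) then $v\in\|\bot\|$; (4) if $w\in\|\bot\|$ then there is $v$ with $wRv$. A $\mathsf{WK}$-model is a $\mathsf{CK}$-model with $\|\bot\|=\varnothing$. Satisfaction. $(\mathcal M,w)\Vdash\bot$ iff $w\in\|\bot\|$; $(\mathcal M,w)\Vdash p$ iff $w\in\|p\|$; $\wedge,\vee$ are interpreted pointwise as usual; $(\mathcal M,w)\Vdash\varphi\to\psi$ iff for all $v\succcurlyeq w$, $(\mathcal M,v)\Vdash\varphi$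 implies $(\mathcal M,v)\Vdash\psi$; $(\mathcal M,w)\Vdash\Box\varphi$ iff $(\mathcal M,v)\Vdash\varphi$ for all $v$ with $w(\preccurlyeq;R)v$; $(\mathcal M,w)\Vdash\Box^*\varphi$ iff $(\mathcal M,v)\Vdash\varphi$ for all $v$ with $w(\preccurlyeq;R)^*v$. A formula is valid in a model if it is satisfied at all its worlds. -}

module Defs where

open import Level using (Level; _⊔_; suc)
open import Data.Product using (∃; _×_)
open import Data.Sum using (_⊎_)
open import Relation.Binary.Core using (Rel)
open import Relation.Binary.Structures using (IsPreorder)
open import Relation.Binary.PropositionalEquality using (_≡_)
open import Relation.Binary.Construct.Composition using () renaming (_;_ to _⨾_)
open import Relation.Binary.Construct.Closure.ReflexiveTransitive using (Star)
open import Relation.Unary using (Pred; _∈_; _⊆_; Empty)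

infixr 6 _∧_
infixr 5 _∨_
infixr 4 _⇒_
infixr 7 □_ □*_

data Formula {p : Level} (PropSym : Set p) : Set p where
  ⊥   : Formula PropSym
  var : PropSym → Formula PropSym
  _∧_ : Formula PropSym → Formula PropSym → Formula PropSym
  _∨_ : Formula PropSym → Formula PropSym → Formula PropSym
  _⇒_ : Formula PropSym → Formula PropSym → Formula PropSym
  □_  : Formula PropSym → Formula PropSym
  □*_ : Formula PropSym → Formula PropSym

-- The valuation on PropSym ∪ {⊥} is split into its value at ⊥ (‖⊥‖, the set
-- of fallible worlds) and its restriction to PropSym (‖_‖).
record CKModel {p : Level} (PropSym : Set p) (ℓ : Level) : Set (p ⊔ suc ℓ) where
  infix 4 _≼_
  field
    W          : Set ℓ
    _≼_        : Rel W ℓ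
    isPreorder : IsPreorder _≡_ _≼_
    R          : Rel W ℓ
    ‖⊥‖        : Pred W ℓ
    ‖_‖        : PropSym → Pred W ℓ
    ⊥-least    : ∀ q → ‖⊥‖ ⊆ ‖ q ‖
    upward     : ∀ q {w v} → w ≼ v → w ∈ ‖ q ‖ → v ∈ ‖ q ‖
    ⊥-closed   : ∀ {w v} → w ∈ ‖⊥‖ → w ≼ v ⊎ R w v → v ∈ ‖⊥‖
    ⊥-serial   : ∀ {w} → w ∈ ‖⊥‖ → ∃ λ v → R w v

IsWK : ∀ {p ℓ} {PropSym : Set p} → CKModel PropSym ℓ → Set ℓ
IsWK M = Empty (CKModel.‖⊥‖ M)

module _ {p ℓ : Level} {PropSym : Set p} (M : CKModel PropSym ℓ) where
  open CKModel M

  infix 3 _⊩_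

  _⊩_ : W → Formula PropSym → Set ℓ
  w ⊩ ⊥       = w ∈ ‖⊥‖
  w ⊩ (var q) = w ∈ ‖ q ‖
  w ⊩ (φ ∧ ψ) = (w ⊩ φ) × (w ⊩ ψ)
  w ⊩ (φ ∨ ψ) = (w ⊩ φ) ⊎ (w ⊩ ψ)
  w ⊩ (φ ⇒ ψ) = ∀ v → w ≼ v → v ⊩ φ → v ⊩ ψ
  w ⊩ (□ φ)   = ∀ v → (_≼_ ⨾ R) w v → v ⊩ φ
  w ⊩ (□* φ)  = ∀ v → Star (_≼_ ⨾ R) w v → v ⊩ φ

  ValidIn : Formula PropSym → Set ℓ
  ValidIn φ = ∀ w → w ⊩ φ

CKValid : ∀ {p} (ℓ : Level) {PropSym : Set p} → Formula PropSym → Set (p ⊔ suc ℓ)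
CKValid ℓ {PropSym} φ = (M : CKModel PropSym ℓ) → ValidIn M φ

WKValid : ∀ {p} (ℓ : Level) {PropSym : Set p} → Formula PropSym → Set (p ⊔ suc ℓ)
WKValid ℓ {PropSym} φ = (M : CKModel PropSym ℓ) → IsWK M → ValidIn M φ

{-# OPTIONS --safe #-}

-- In a CK-model a fallible world forces every formula, and every world reachable
-- from it is fallible. So deleting the fallible worlds changes the truth of no
-- formula at the remaining ones, and what remains is a WK-model.
module Submission where

open import Level using (Level)
open import Axiom.ExcludedMiddle using (ExcludedMiddle)
open import Data.Empty using (⊥-elim)
open import Data.Product using (Σ-syntax; _,_; proj₁; proj₂)
open import Data.Sum using (_⊎_; inj₁; inj₂)
open import Function.Base using (_on_)
open import Function.Bundles using (_⇔_; mk⇔)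
open import Relation.Binary.Construct.Closure.ReflexiveTransitive using (Star; ε; _◅_; gmap)
open import Relation.Binary.Construct.Composition using () renaming (_;_ to _⨾_)
open import Relation.Binary.PropositionalEquality using (isEquivalence; refl)
open import Relation.Binary.Structures using (IsPreorder)
open import Relation.Nullary using (yes; no)
open import Relation.Unary using (_∈_; _∉_)
open import Defs

module _ {p ℓ : Level} {PropSym : Set p} (M : CKModel PropSym ℓ) where
  open CKModel M

  ⊥-closed-step : ∀ {w v} → w ∈ ‖⊥‖ → (_≼_ ⨾ R) w v → v ∈ ‖⊥‖
  ⊥-closed-step f (_ , w≼z , zRv) = ⊥-closed (⊥-closed f (inj₁ w≼z)) (inj₂ zRv)

  ⊥-closed-path : ∀ {w v} → w ∈ ‖⊥‖ → Star (_≼_ ⨾ R) w v → v ∈ ‖⊥‖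
  ⊥-closed-path f ε        = f
  ⊥-closed-path f (s ◅ ss) = ⊥-closed-path (⊥-closed-step f s) ss

  -- Induction on `φ`: atoms hold by `⊥-least`, and for `⇒`, `□` and `□*` each world quantified over
  -- is again fallible by closure.
  ⊥-explosive : ∀ φ {w} → w ∈ ‖⊥‖ → _⊩_ M w φ
  ⊥-explosive ⊥       f = f
  ⊥-explosive (var q) f = ⊥-least q f
  ⊥-explosive (φ ∧ ψ) f = ⊥-explosive φ f , ⊥-explosive ψ f
  ⊥-explosive (φ ∨ ψ) f = inj₁ (⊥-explosive φ f)
  ⊥-explosive (φ ⇒ ψ) f = λ v w≼v _ → ⊥-explosive ψ (⊥-closed f (inj₁ w≼v))
  ⊥-explosive (□ φ)   f = λ v s → ⊥-explosive φ (⊥-closed-step f s)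
  ⊥-explosive (□* φ)  f = λ v ss → ⊥-explosive φ (⊥-closed-path f ss)

  -- `‖⊥‖` is pulled back along `proj₁` rather than set to the empty predicate, so forcing of `⊥`
  -- agrees definitionally with `M`.
  infallible : CKModel PropSym ℓ
  infallible = record
    { W          = Σ[ w ∈ W ] w ∉ ‖⊥‖
    ; _≼_        = _≼_ on proj₁
    ; isPreorder = record
      { isEquivalence = isEquivalence
      ; reflexive     = λ { refl → ≼.refl }
      ; trans         = ≼.trans
      }
    ; R          = R on proj₁
    ; ‖⊥‖        = λ w → proj₁ w ∈ ‖⊥‖
    ; ‖_‖        = λ q w → proj₁ w ∈ ‖ q ‖
    ; ⊥-least    = λ q → ⊥-least q
    ; upward     = λ q → upward q
    ; ⊥-closed   = ⊥-closed
    ; ⊥-serial   = λ {w} f → ⊥-elim (proj₂ w f)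
    }
    where module ≼ = IsPreorder isPreorder

  infallible-isWK : IsWK infallible
  infallible-isWK = proj₂

  module _ (em : ExcludedMiddle ℓ) where
    private
      module I = CKModel infallible

    -- The intermediate world also survives: if it were fallible, closure under `R` would make `v`
    -- fallible.
    restrict-step : ∀ {w v} (n : w ∉ ‖⊥‖) (m : v ∉ ‖⊥‖) →
                    (_≼_ ⨾ R) w v → (I._≼_ ⨾ I.R) (w , n) (v , m)
    restrict-step n m (z , w≼z , zRv) =
      (z , λ f → m (⊥-closed f (inj₂ zRv))) , w≼z , zRv

    -- The infallibility proof of the endpoint is existential because, without
    -- function extensionality, such proofs need not be equal.
    restrict-path : ∀ {w v} (n : w ∉ ‖⊥‖) → Star (_≼_ ⨾ R) w v →
                    v ∈ ‖⊥‖ ⊎ (Σ[ m ∈ v ∉ ‖⊥‖ ] Star (I._≼_ ⨾ I.R) (w , n) (v , m))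
    restrict-path n ε = inj₂ (n , ε)
    restrict-path n (_◅_ {j = u} s ss) with em {u ∈ ‖⊥‖}
    ... | yes f = inj₁ (⊥-closed-path f ss)
    ... | no n′ with restrict-path n′ ss
    ...   | inj₁ f         = inj₁ f
    ...   | inj₂ (m , ss′) = inj₂ (m , restrict-step n n′ s ◅ ss′)

    -- The two directions are proved by mutual induction because the antecedent of `⇒` is
    -- contravariant.
    ⊩-restrict : ∀ φ {w} (n : w ∉ ‖⊥‖) → _⊩_ M w φ → _⊩_ infallible (w , n) φ
    ⊩-extend   : ∀ φ {w} (n : w ∉ ‖⊥‖) → _⊩_ infallible (w , n) φ → _⊩_ M w φ

    ⊩-restrict ⊥       n h = h
    ⊩-restrict (var q) n h = h
    ⊩-restrict (φ ∧ ψ) n (h , k) = ⊩-restrict φ n h , ⊩-restrict ψ n k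
    ⊩-restrict (φ ∨ ψ) n (inj₁ h) = inj₁ (⊩-restrict φ n h)
    ⊩-restrict (φ ∨ ψ) n (inj₂ k) = inj₂ (⊩-restrict ψ n k)
    ⊩-restrict (φ ⇒ ψ) n h (v , m) w≼v k = ⊩-restrict ψ m (h v w≼v (⊩-extend φ m k))
    ⊩-restrict (□ φ)   n h (v , m) ((z , _) , w≼z , zRv) =
      ⊩-restrict φ m (h v (z , w≼z , zRv))
    ⊩-restrict (□* φ)  n h (v , m) ss =
      ⊩-restrict φ m (h v (gmap proj₁ (λ ((z , _) , w≼z , zRv) → z , w≼z , zRv) ss))

    ⊩-extend ⊥       n h = h
    ⊩-extend (var q) n h = h
    ⊩-extend (φ ∧ ψ) n (h , k) = ⊩-extend φ n h , ⊩-extend ψ n k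
    ⊩-extend (φ ∨ ψ) n (inj₁ h) = inj₁ (⊩-extend φ n h)
    ⊩-extend (φ ∨ ψ) n (inj₂ k) = inj₂ (⊩-extend ψ n k)
    -- In `M` the quantifier also reaches fallible worlds, about which `h` says nothing; there
    -- explosion gives the conclusion.
    ⊩-extend (φ ⇒ ψ) n h v w≼v k with em {v ∈ ‖⊥‖}
    ... | yes f = ⊥-explosive ψ f
    ... | no m  = ⊩-extend ψ m (h (v , m) w≼v (⊩-restrict φ m k))
    ⊩-extend (□ φ)   n h v s with em {v ∈ ‖⊥‖}
    ... | yes f = ⊥-explosive φ f
    ... | no m  = ⊩-extend φ m (h (v , m) (restrict-step n m s))
    -- A path that meets a fallible world stays fallible up to its end, so either `v` is fallible or
    -- the whole path lies in `infallible`.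
    ⊩-extend (□* φ)  n h v ss with restrict-path n ss
    ... | inj₁ f         = ⊥-explosive φ f
    ... | inj₂ (m , ss′) = ⊩-extend φ m (h (v , m) ss′)

    infallible-valid⇒valid : ∀ φ → ValidIn infallible φ → ValidIn M φ
    infallible-valid⇒valid φ valid w with em {w ∈ ‖⊥‖}
    ... | yes f = ⊥-explosive φ f
    ... | no n  = ⊩-extend φ n (valid (w , n))

proposition2p7 : ∀ {p ℓ : Level} → ExcludedMiddle ℓ →
    (PropSym : Set p) (φ : Formula PropSym) →
    CKValid ℓ φ ⇔ WKValid ℓ φ
proposition2p7 em PropSym φ = mk⇔
  (λ ck M _ → ck M)
  -- `infallible M` lives at the same level `ℓ` as `M`, so `wk` applies to it.
  (λ wk M → infallible-valid⇒valid M em φ (wk (infallible M) (infallible-isWK M)))
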